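{- If $q$ is a power of an odd prime, then the graph $G_q$ is isomorphic to an induced subgraph of $ER_q$.
   Context: For a power $q$ of an odd prime, let $A=\{(a,a^2):a\in\mathbb{F}_q\}\subset\mathbb{F}_q^2$. The graph $G_q$ has vertex set $\mathbb{F}_q\times\mathbb{F}_q$, and distinct vertices $(x_1,x_2)$ and $(y_1,y_2)$ are adjacent if and only if $(x_1,x_2)+(y_1,y_2)\in A$ (equivalently $(x_1+y_1)^2=x_2+y_2$); $G_q$ has no loops. $ER_q$ is the graph whose vertices are the points of $PG(2,q)$, i.e. the $1$-dimensional subspaces of $\mathbb{F}_q^3$, where distinct vertices $(x_0,x_1,x_2)$ and $(y_0,y_1,y_2)$ (homogeneous coordinates) are adjacent if and only if $x_0y_0+x_1y_1+x_2y_2=0$. -}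

module Defs where

open import Algebra.Apartness.Bundles using (HeytingCommutativeRing; HeytingField)
open import Algebra.Bundles using (CommutativeRing)
open import Algebra.Module.Bundles using (Module)
import Algebra.Module.Construct.DirectProduct as Product
import Algebra.Module.Construct.TensorUnit as Unit
open import Data.Fin.Base using (Fin)
open import Data.Nat.Base using (ℕ; _≤_; _^_)
open import Data.Nat.Divisibility using (_∣_)
open import Data.Nat.Primality using (Prime)
open import Data.Product.Base using (∃; ∃-syntax; ∃₂; Σ-syntax; _×_; _,_; proj₁; proj₂)
open import Function.Bundles using (Inverse; _⇔_)
open import Level using (Level; _⊔_; suc)
open import Relation.Binary.Bundles using (Setoid)
import Relation.Binary.Construct.On as On
open import Relation.Binary.Core using (Rel)
open import Relation.Binary.Definitions using (Irreflexive; Symmetric; _Respects_; _Respects₂_)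
import Relation.Binary.PropositionalEquality as ≡
import Relation.Binary.Reasoning.Setoid as ≈-Reasoning
open import Relation.Nullary.Negation using (¬_)
open import Relation.Unary using (Pred; _∈_)
open import Relation.Unary.Relation.Binary.Equality using (≐-setoid)

private
  variable
    v v′ ℓ ℓ′ e e′ : Level

record Graph (v ℓ e : Level) : Set (suc (v ⊔ ℓ ⊔ e)) where
  field
    vertices : Setoid v ℓ

  open Setoid vertices public
    using (_≈_; _≉_) renaming (Carrier to Vertex)

  field
    Adjacent        : Rel Vertex e
    adjacent-resp   : Adjacent Respects₂ _≈_
    adjacent-sym    : Symmetric Adjacent
    adjacent-irrefl : Irreflexive _≈_ Adjacent

induced : ∀ {p} (H : Graph v ℓ e) → Pred (Graph.Vertex H) p → Graph (v ⊔ p) ℓ e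
induced H S = record
  { vertices        = On.setoid vertices (proj₁ {B = S})
  ; Adjacent        = λ x y → Adjacent (proj₁ x) (proj₁ y)
  ; adjacent-resp   = proj₁ adjacent-resp , proj₂ adjacent-resp
  ; adjacent-sym    = adjacent-sym
  ; adjacent-irrefl = adjacent-irrefl
  }
  where open Graph H

infix 4 _≅_

_≅_ : Graph v ℓ e → Graph v′ ℓ′ e′ → Set (v ⊔ ℓ ⊔ e ⊔ v′ ⊔ ℓ′ ⊔ e′)
G ≅ H =
  Σ[ f ∈ Inverse G.vertices H.vertices ]
    (∀ x y → G.Adjacent x y ⇔ H.Adjacent (Inverse.to f x) (Inverse.to f y))
  where
  module G = Graph G
  module H = Graph H

-- The level of S is the one at which the image of a map
-- from G to H, λ y → ∃ λ x → f x ≈ y, lives.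
IsomorphicToInducedSubgraph :
  Graph v ℓ e → Graph v′ ℓ′ e′ → Set (suc (v ⊔ ℓ′) ⊔ ℓ ⊔ e ⊔ v′ ⊔ e′)
IsomorphicToInducedSubgraph {v = v} {ℓ′ = ℓ′} G H =
  Σ[ S ∈ Pred H.Vertex (v ⊔ ℓ′) ] (S Respects H._≈_) × (G ≅ induced H S)
  where module H = Graph H

IsOddPrimePower : ℕ → Set
IsOddPrimePower q = ∃₂ λ p k → Prime p × ¬ (2 ∣ p) × 1 ≤ k × q ≡.≡ p ^ k

module _ {c ℓ₁ ℓ₂} (F : HeytingField c ℓ₁ ℓ₂) where

  private
    commutativeRing : CommutativeRing c ℓ₁
    commutativeRing =
      HeytingCommutativeRing.commutativeRing (HeytingField.heytingCommutativeRing F)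

  open CommutativeRing commutativeRing

  -- For a field of finite order _≈_ is decidable, so the apartness of F
  -- coincides with _≉_ and F is a field in the usual sense.
  HasOrder : ℕ → Set (c ⊔ ℓ₁)
  HasOrder q = Inverse setoid (≡.setoid (Fin q))

  F¹ F² F³ : Module commutativeRing c ℓ₁
  F¹ = Unit.⟨module⟩
  F² = Product.⟨module⟩ F¹ F¹
  F³ = Product.⟨module⟩ F¹ F²

  module F² = Module F²
  module F³ = Module F³

  A : Pred F².Carrierᴹ (c ⊔ ℓ₁)
  A z = ∃[ a ] z F².≈ᴹ (a , a * a)

  G : Graph c ℓ₁ (c ⊔ ℓ₁)
  G = record
    { vertices        = F².≈ᴹ-setoid
    ; Adjacent        = λ x y → ¬ (x F².≈ᴹ y) × (x F².+ᴹ y) ∈ A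
    ; adjacent-resp   =
        (λ y≈z (x≉y , a , x+y≈a) →
          (λ x≈z → x≉y (F².≈ᴹ-trans x≈z (F².≈ᴹ-sym y≈z))) ,
          a , F².≈ᴹ-trans (F².+ᴹ-cong F².≈ᴹ-refl (F².≈ᴹ-sym y≈z)) x+y≈a) ,
        (λ x≈z (x≉y , a , x+y≈a) →
          (λ z≈y → x≉y (F².≈ᴹ-trans x≈z z≈y)) ,
          a , F².≈ᴹ-trans (F².+ᴹ-cong (F².≈ᴹ-sym x≈z) F².≈ᴹ-refl) x+y≈a)
    ; adjacent-sym    = λ {x} {y} (x≉y , a , x+y≈a) →
        (λ y≈x → x≉y (F².≈ᴹ-sym y≈x)) ,
        a , F².≈ᴹ-trans (F².+ᴹ-comm y x) x+y≈a
    ; adjacent-irrefl = λ x≈y (x≉y , _) → x≉y x≈y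
    }

  span : F³.Carrierᴹ → Pred F³.Carrierᴹ (c ⊔ ℓ₁)
  span u w = ∃[ a ] w F³.≈ᴹ a F³.*ₗ u

  infix 8 _·_

  _·_ : F³.Carrierᴹ → F³.Carrierᴹ → Carrier
  (x₀ , x₁ , x₂) · (y₀ , y₁ , y₂) = x₀ * y₀ + x₁ * y₁ + x₂ * y₂

  -- A one-dimensional subspace of F³ is given by a spanning vector, its
  -- homogeneous coordinates; two points are equal when their spans are
  -- equal as subsets of F³.
  record Point : Set (c ⊔ ℓ₁) where
    field
      coordinates : F³.Carrierᴹ
      nonzero     : ¬ (coordinates F³.≈ᴹ F³.0ᴹ)

  open Point public

  PG2 : Setoid (c ⊔ ℓ₁) (c ⊔ ℓ₁)
  PG2 = On.setoid (≐-setoid F³.Carrierᴹ (c ⊔ ℓ₁)) (λ P → span (coordinates P))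

  module PG2 = Setoid PG2

  ·-comm : ∀ x y → x · y ≈ y · x
  ·-comm (x₀ , x₁ , x₂) (y₀ , y₁ , y₂) =
    +-cong (+-cong (*-comm x₀ y₀) (*-comm x₁ y₁)) (*-comm x₂ y₂)

  ·-congˡ : ∀ x {y z} → y F³.≈ᴹ z → x · y ≈ x · z
  ·-congˡ x (y₀≈z₀ , y₁≈z₁ , y₂≈z₂) =
    +-cong (+-cong (*-congˡ y₀≈z₀) (*-congˡ y₁≈z₁)) (*-congˡ y₂≈z₂)

  ·-scale : ∀ a x y → (a F³.*ₗ x) · y ≈ a * x · y
  ·-scale a (x₀ , x₁ , x₂) (y₀ , y₁ , y₂) = begin
    a * x₀ * y₀ + a * x₁ * y₁ + a * x₂ * y₂
      ≈⟨ +-cong (+-cong (*-assoc a x₀ y₀) (*-assoc a x₁ y₁)) (*-assoc a x₂ y₂) ⟩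
    a * (x₀ * y₀) + a * (x₁ * y₁) + a * (x₂ * y₂)
      ≈⟨ +-congʳ (distribˡ a (x₀ * y₀) (x₁ * y₁)) ⟨
    a * (x₀ * y₀ + x₁ * y₁) + a * (x₂ * y₂)
      ≈⟨ distribˡ a (x₀ * y₀ + x₁ * y₁) (x₂ * y₂) ⟨
    a * (x₀ * y₀ + x₁ * y₁ + x₂ * y₂) ∎
    where open ≈-Reasoning setoid

  orthogonal-resp : ∀ x {P Q} → P PG2.≈ Q →
                    x · coordinates P ≈ 0# → x · coordinates Q ≈ 0#
  orthogonal-resp x {P} {Q} (_ , Q⊆P) x·P≈0 = begin
    x · q            ≈⟨ ·-congˡ x q≈ap ⟩
    x · (a F³.*ₗ p)  ≈⟨ ·-comm x (a F³.*ₗ p) ⟩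
    (a F³.*ₗ p) · x  ≈⟨ ·-scale a p x ⟩
    a * p · x        ≈⟨ *-congˡ (·-comm p x) ⟩
    a * x · p        ≈⟨ *-congˡ x·P≈0 ⟩
    a * 0#           ≈⟨ zeroʳ a ⟩
    0#               ∎
    where
    open ≈-Reasoning setoid
    p q : F³.Carrierᴹ
    p = coordinates P
    q = coordinates Q
    q∈spanp : q ∈ span p
    q∈spanp = Q⊆P (1# , F³.≈ᴹ-sym (F³.*ₗ-identityˡ q))
    a = proj₁ q∈spanp
    q≈ap = proj₂ q∈spanp

  ER : Graph (c ⊔ ℓ₁) (c ⊔ ℓ₁) (c ⊔ ℓ₁)
  ER = record
    { vertices        = PG2
    ; Adjacent        = λ P Q → ¬ (P PG2.≈ Q) × coordinates P · coordinates Q ≈ 0#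
    ; adjacent-resp   =
        (λ {P} {Q} {R} Q≈R (P≉Q , P·Q≈0) →
          (λ P≈R → P≉Q (PG2.trans {P} {R} {Q} P≈R (PG2.sym {Q} {R} Q≈R))) ,
          orthogonal-resp (coordinates P) {Q} {R} Q≈R P·Q≈0) ,
        (λ {P} {Q} {R} Q≈R (Q≉P , Q·P≈0) →
          (λ R≈P → Q≉P (PG2.trans {Q} {R} {P} Q≈R R≈P)) ,
          trans (·-comm (coordinates R) (coordinates P))
            (orthogonal-resp (coordinates P) {Q} {R} Q≈R
              (trans (·-comm (coordinates P) (coordinates Q)) Q·P≈0)))
    ; adjacent-sym    = λ {P} {Q} (P≉Q , P·Q≈0) →
        (λ Q≈P → P≉Q (PG2.sym {Q} {P} Q≈P)) ,
        trans (·-comm (coordinates Q) (coordinates P)) P·Q≈0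
    ; adjacent-irrefl = λ P≈Q (P≉Q , _) → P≉Q P≈Q
    }

{-# OPTIONS --safe #-}

-- With w = x₂ - x₁², adjacency in G says 2 x₁ y₁ = w + w′, a condition given by
-- the symmetric bilinear form with matrix [[0,0,1],[0,-2,0],[1,0,0]] in the
-- coordinates (1, x₁, w).  Choose a, b with a² + b² = -1.  The vectors
-- e = (1, a, b), f = (0, -2b, 2a), g = (1, -a, -b) have e·e = g·g = e·f = f·g = 0,
-- e·g = 2 and f·f = -4, so x ↦ e + x₁ f + w g carries twice that form to the
-- dot product of F³.
module Submission where

open import Defs
open import Algebra.Apartness.Bundles using (HeytingField; HeytingCommutativeRing)
open import Algebra.Bundles using (CommutativeRing)
open import Algebra.Solver.Ring.AlmostCommutativeRing
  using (fromCommutativeRing; _-Raw-AlmostCommutative⟶_)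
import Algebra.Apartness.Properties.HeytingCommutativeRing as HeytingCommutativeRingProperties
import Algebra.Properties.CommutativeMonoid.Sum as Sum
import Algebra.Properties.Ring as RingProperties
import Algebra.Properties.Semiring.Mult as Mult
import Algebra.Properties.Semiring.Mult.TCOptimised as Multᵒ
import Algebra.Solver.Ring as RingSolver
open import Data.Fin.Base using (Fin; zero; suc; toℕ)
open import Data.Fin.Properties using (pigeonhole; toℕ-injective)
open import Data.Integer.Base as ℤ using (ℤ; +_; -[1+_]; _⊖_)
import Data.Integer.Properties as ℤ
open import Data.Maybe.Base using (Maybe; map)
open import Data.Nat.Base as ℕ using (ℕ; zero; suc; _^_; s≤s)
open import Data.Nat.Divisibility using (_∣_; _∣0; ∣-refl; ∣1⇒≡1; ∣m∣n⇒∣m+n)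
import Data.Nat.Properties as ℕ
open import Data.Nat.Primality using (euclidsLemma; prime[2])
open import Data.Product.Base using (∃; ∃₂; _,_; proj₁)
open import Data.Sum.Base using (inj₁; inj₂)
open import Function.Base using (_∘_; const)
open import Function.Bundles using (Inverse; mk⇔)
import Function.Construct.Composition as Composition
import Function.Construct.Symmetry as Symmetry
open import Relation.Binary.Consequences using (dec⇒weaklyDec)
open import Relation.Binary.PropositionalEquality as ≡ using (_≡_)
import Relation.Binary.Reasoning.Setoid as ≈-Reasoning
open import Relation.Nullary.Decidable.Core using (Dec; yes; no)
open import Relation.Nullary.Negation using (¬_; contradiction)

-- Ring solver with integer coefficients.

module IntegerCoefficients {c ℓ} (R : CommutativeRing c ℓ) where

  open CommutativeRing R
  open RingProperties ring
  open Multᵒ semiring using (×-homo-+; ×1-homo-*; 1+×) renaming (_×_ to _×′_)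
  open ≈-Reasoning setoid

  -- The canonical map from ℤ. With the optimised multiple, `1 ×′ 1#` computes to `1#`, so
  -- `con (+ 1)` in a solver expression denotes `1#` itself.
  ⟦_⟧ : ℤ → Carrier
  ⟦ + n ⟧      = n ×′ 1#
  ⟦ -[1+ n ] ⟧ = - (suc n ×′ 1#)

  ⟦-⟧-homo : ∀ i → ⟦ ℤ.- i ⟧ ≈ - ⟦ i ⟧
  ⟦-⟧-homo (+ zero)     = sym -0#≈0#
  ⟦-⟧-homo (+ (suc n))  = refl
  ⟦-⟧-homo -[1+ n ]     = sym (-‿involutive _)

  ⟦⊖⟧-homo : ∀ m n → ⟦ m ⊖ n ⟧ ≈ m ×′ 1# - n ×′ 1#
  ⟦⊖⟧-homo m       zero    = sym (trans (+-congˡ -0#≈0#) (+-identityʳ _))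
  ⟦⊖⟧-homo zero    (suc n) = sym (+-identityˡ _)
  ⟦⊖⟧-homo (suc m) (suc n) = begin
    ⟦ suc m ⊖ suc n ⟧                    ≡⟨ ≡.cong ⟦_⟧ (ℤ.[1+m]⊖[1+n]≡m⊖n m n) ⟩
    ⟦ m ⊖ n ⟧                            ≈⟨ ⟦⊖⟧-homo m n ⟩
    m ×′ 1# - n ×′ 1#                    ≈⟨ +-congʳ (xyx⁻¹≈y 1# (m ×′ 1#)) ⟨
    1# + m ×′ 1# - 1# - n ×′ 1#          ≈⟨ +-assoc _ _ _ ⟩
    1# + m ×′ 1# + (- 1# - n ×′ 1#)      ≈⟨ +-congˡ (-‿+-comm 1# (n ×′ 1#)) ⟩
    1# + m ×′ 1# - (1# + n ×′ 1#)        ≈⟨ +-cong (1+× m 1#) (-‿cong (1+× n 1#)) ⟨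
    suc m ×′ 1# - suc n ×′ 1#            ∎

  ⟦+⟧-homo : ∀ i j → ⟦ i ℤ.+ j ⟧ ≈ ⟦ i ⟧ + ⟦ j ⟧
  ⟦+⟧-homo (+ m)    (+ n)    = ×-homo-+ 1# m n
  ⟦+⟧-homo (+ m)    -[1+ n ] = ⟦⊖⟧-homo m (suc n)
  ⟦+⟧-homo -[1+ m ] (+ n)    = trans (⟦⊖⟧-homo n (suc m)) (+-comm _ _)
  ⟦+⟧-homo -[1+ m ] -[1+ n ] = begin
    - (suc (suc (m ℕ.+ n)) ×′ 1#)       ≡⟨ ≡.cong (λ k → - (suc k ×′ 1#)) (ℕ.+-suc m n) ⟨
    - ((suc m ℕ.+ suc n) ×′ 1#)         ≈⟨ -‿cong (×-homo-+ 1# (suc m) (suc n)) ⟩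
    - (suc m ×′ 1# + suc n ×′ 1#)       ≈⟨ -‿+-comm _ _ ⟨
    - (suc m ×′ 1#) - suc n ×′ 1#       ∎

  ⟦*⟧-homo-+ˡ : ∀ m j → ⟦ + m ℤ.* j ⟧ ≈ ⟦ + m ⟧ * ⟦ j ⟧
  ⟦*⟧-homo-+ˡ m (+ n)    = begin
    ⟦ + m ℤ.* + n ⟧         ≡⟨ ≡.cong ⟦_⟧ (ℤ.pos-* m n) ⟨
    (m ℕ.* n) ×′ 1#         ≈⟨ ×1-homo-* m n ⟩
    m ×′ 1# * (n ×′ 1#)     ∎
  ⟦*⟧-homo-+ˡ m -[1+ n ] = begin
    ⟦ + m ℤ.* -[1+ n ] ⟧          ≡⟨ ≡.cong ⟦_⟧ (ℤ.neg-distribʳ-* (+ m) (+ suc n)) ⟨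
    ⟦ ℤ.- (+ m ℤ.* + suc n) ⟧     ≈⟨ ⟦-⟧-homo (+ m ℤ.* + suc n) ⟩
    - ⟦ + m ℤ.* + suc n ⟧         ≈⟨ -‿cong (⟦*⟧-homo-+ˡ m (+ suc n)) ⟩
    - (m ×′ 1# * (suc n ×′ 1#))   ≈⟨ -‿distribʳ-* _ _ ⟩
    m ×′ 1# * - (suc n ×′ 1#)     ∎

  ⟦*⟧-homo : ∀ i j → ⟦ i ℤ.* j ⟧ ≈ ⟦ i ⟧ * ⟦ j ⟧
  ⟦*⟧-homo (+ m)    j = ⟦*⟧-homo-+ˡ m j
  ⟦*⟧-homo -[1+ m ] j = begin
    ⟦ -[1+ m ] ℤ.* j ⟧         ≡⟨ ≡.cong ⟦_⟧ (ℤ.neg-distribˡ-* (+ suc m) j) ⟨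
    ⟦ ℤ.- (+ suc m ℤ.* j) ⟧    ≈⟨ ⟦-⟧-homo (+ suc m ℤ.* j) ⟩
    - ⟦ + suc m ℤ.* j ⟧        ≈⟨ -‿cong (⟦*⟧-homo-+ˡ (suc m) j) ⟩
    - (suc m ×′ 1# * ⟦ j ⟧)    ≈⟨ -‿distribˡ-* _ _ ⟩
    - (suc m ×′ 1#) * ⟦ j ⟧    ∎

  homomorphism : ℤ.+-*-rawRing -Raw-AlmostCommutative⟶ fromCommutativeRing R
  homomorphism = record
    { ⟦_⟧    = ⟦_⟧
    ; +-homo = ⟦+⟧-homo
    ; *-homo = ⟦*⟧-homo
    ; -‿homo = ⟦-⟧-homo
    ; 0-homo = refl
    ; 1-homo = refl
    }

  -- Distinct integers may have equal images in positive characteristic, so only a positive answer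
  -- is ever given.
  ⟦⟧-weaklyDec : ∀ i j → Maybe (⟦ i ⟧ ≈ ⟦ j ⟧)
  ⟦⟧-weaklyDec i j = map (reflexive ∘ ≡.cong ⟦_⟧) (dec⇒weaklyDec ℤ._≟_ i j)

  open RingSolver ℤ.+-*-rawRing (fromCommutativeRing R) homomorphism ⟦⟧-weaklyDec public
    using (solve; con; _:+_; _:*_; _:-_; :-_; _:=_)

-- Parity of powers.

2∣m^n⇒2∣m : ∀ m n → 2 ∣ m ^ n → 2 ∣ m
2∣m^n⇒2∣m m zero    2∣1 = contradiction (∣1⇒≡1 2∣1) λ ()
2∣m^n⇒2∣m m (suc n) 2∣m*m^n with euclidsLemma m (m ^ n) prime[2] 2∣m*m^n
... | inj₁ 2∣m   = 2∣m
... | inj₂ 2∣m^n = 2∣m^n⇒2∣m m n 2∣m^n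

-- Cancellation, square roots and characteristic in a field.

module _ {c ℓ₁ ℓ₂} (F : HeytingField c ℓ₁ ℓ₂) where

  open HeytingField F using (tight; #⇒invertible; #-irrefl; heytingCommutativeRing)
  open HeytingCommutativeRingProperties heytingCommutativeRing using (1#0; x-0≈x)
  open CommutativeRing (HeytingCommutativeRing.commutativeRing heytingCommutativeRing)
  open RingProperties ring
    using (x≈y⇒x∙y⁻¹≈ε; x∙y⁻¹≈ε⇒x≈y; -‿involutive; -0#≈0#; -‿injective; +-cancelˡ;
           +-identityʳ-unique; x[y-z]≈xy-xz)
  open IntegerCoefficients (HeytingCommutativeRing.commutativeRing heytingCommutativeRing)
    using (solve; con; _:+_; _:*_; _:-_; :-_; _:=_)
  open Mult semiring using () renaming (_×_ to _×ⁿ_)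
  open ≈-Reasoning setoid

  1≉0 : 1# ≉ 0#
  1≉0 1≈0 = #-irrefl 1≈0 1#0

  [x-y]+y≈x : ∀ x y → x - y + y ≈ x
  [x-y]+y≈x = solve 2 (λ x y → x :- y :+ y := x) refl

  -- By tightness it suffices to refute `y # 0#`: an inverse of `y` would cancel to give `x ≈ 0#`.
  xy≈0∧x≉0⇒y≈0 : ∀ {x y} → x * y ≈ 0# → x ≉ 0# → y ≈ 0#
  xy≈0∧x≉0⇒y≈0 {x} {y} xy≈0 x≉0 = proj₁ (tight y 0#) λ y#0 →
    let y⁻¹ , _ , yy⁻¹≈1 = #⇒invertible y#0 in x≉0 (begin
      x                       ≈⟨ *-identityʳ x ⟨
      x * 1#                  ≈⟨ *-congˡ yy⁻¹≈1 ⟨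
      x * ((y - 0#) * y⁻¹)    ≈⟨ *-congˡ (*-congʳ (x-0≈x y)) ⟩
      x * (y * y⁻¹)           ≈⟨ *-assoc x y y⁻¹ ⟨
      x * y * y⁻¹             ≈⟨ *-congʳ xy≈0 ⟩
      0# * y⁻¹                ≈⟨ zeroˡ y⁻¹ ⟩
      0#                      ∎)

  -- The difference of squares factors, and the factor `x - y` is nonzero.
  x²≈y²∧x≉y⇒x≈-y : ∀ {x y} → x * x ≈ y * y → x ≉ y → x ≈ - y
  x²≈y²∧x≉y⇒x≈-y {x} {y} x²≈y² x≉y =
    x∙y⁻¹≈ε⇒x≈y x (- y) (xy≈0∧x≉0⇒y≈0
      (trans (solve 2 (λ x y → (x :- y) :* (x :- (:- y)) := x :* x :- y :* y) refl x y)
             (x≈y⇒x∙y⁻¹≈ε x²≈y²))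
      (x≉y ∘ x∙y⁻¹≈ε⇒x≈y x y))

  -- When `1# + 1#` vanishes, removing two from `n` keeps `n ×ⁿ 1#` unchanged; the descent cannot
  -- end at 1 since `1# ≉ 0#`.
  2×1≈0∧n×1≈0⇒2∣n : 1# + 1# ≈ 0# → ∀ n → n ×ⁿ 1# ≈ 0# → 2 ∣ n
  2×1≈0∧n×1≈0⇒2∣n 2≈0 zero _ = 2 ∣0
  2×1≈0∧n×1≈0⇒2∣n 2≈0 (suc zero) 1+0≈0 =
    contradiction (trans (sym (+-identityʳ 1#)) 1+0≈0) 1≉0
  2×1≈0∧n×1≈0⇒2∣n 2≈0 (suc (suc n)) [2+n]×1≈0 =
    ∣m∣n⇒∣m+n ∣-refl (2×1≈0∧n×1≈0⇒2∣n 2≈0 n (begin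
      n ×ⁿ 1#                ≈⟨ +-identityˡ _ ⟨
      0# + n ×ⁿ 1#           ≈⟨ +-congʳ 2≈0 ⟨
      1# + 1# + n ×ⁿ 1#      ≈⟨ +-assoc _ _ _ ⟩
      1# + (1# + n ×ⁿ 1#)    ≈⟨ [2+n]×1≈0 ⟩
      0#                     ∎))

  -- Finite fields: order times one is zero, and -1 is a sum of two squares.

  module FiniteOrder {q} (order : HasOrder F q) where

    open Inverse order using ()
      renaming (to to index; from to element; to-cong to index-cong)
    open Sum +-commutativeMonoid using (sum; sum-permute; ∑-distrib-+; sum-replicate; sum-cong-≋)

    element-index : ∀ x → element (index x) ≈ x
    element-index = Inverse.strictlyInverseʳ order

    index-element : ∀ i → index (element i) ≡ i
    index-element = Inverse.strictlyInverseˡ order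

    -- Translation by 1 permutes F, so it does not change the sum of all elements.
    order×1≈0 : q ×ⁿ 1# ≈ 0#
    order×1≈0 = +-identityʳ-unique (sum element) (q ×ⁿ 1#) (begin
      sum element + q ×ⁿ 1#                 ≈⟨ +-congˡ (sum-replicate q) ⟨
      sum element + sum {q} (const 1#)      ≈⟨ ∑-distrib-+ element (const 1#) ⟨
      sum (λ i → element i + 1#)
        ≈⟨ sum-cong-≋ (λ i → element-index (element i + 1#)) ⟨
      sum (λ i → element (index (element i + 1#)))
        ≈⟨ sum-permute element permutation ⟨
      sum element                           ∎)
      where
      translation : Inverse setoid setoid
      translation = record
        { to        = _+ 1#
        ; from      = _- 1#
        ; to-cong   = +-congʳ
        ; from-cong = +-congʳ
        ; inverse   =
            (λ {x} {y} y≈x-1 → trans (+-congʳ y≈x-1) ([x-y]+y≈x x 1#)) ,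
            (λ {x} {y} y≈x+1 → trans (+-congʳ y≈x+1)
              (solve 2 (λ x e → x :+ e :- e := x) refl x 1#))
        }
      permutation : Inverse (≡.setoid (Fin q)) (≡.setoid (Fin q))
      permutation =
        Composition.inverse (Composition.inverse (Symmetry.inverse order) translation) order

    index-injective : ∀ {x y} → index x ≡ index y → x ≈ y
    index-injective {x} {y} eq = begin
      x                    ≈⟨ element-index x ⟨
      element (index x)    ≡⟨ ≡.cong element eq ⟩
      element (index y)    ≈⟨ element-index y ⟩
      y                    ∎

    -- Selects one element of each pair {x, - x}, and 0.
    Leading : Carrier → Set
    Leading x = toℕ (index x) ℕ.≤ toℕ (index (- x))

    leading? : ∀ x → Dec (Leading x)
    leading? x = toℕ (index x) ℕ.≤? toℕ (index (- x))

    leading-resp : ∀ {x y} → x ≈ y → Leading x → Leading y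
    leading-resp x≈y = ≡.subst₂ ℕ._≤_
      (≡.cong toℕ (index-cong x≈y)) (≡.cong toℕ (index-cong (-‿cong x≈y)))

    leading-0 : Leading 0#
    leading-0 = ℕ.≤-reflexive (≡.cong toℕ (index-cong (sym -0#≈0#)))

    leading-unique : ∀ {x} → Leading x → Leading (- x) → x ≈ - x
    leading-unique {x} x≤-x -x≤--x = index-injective (toℕ-injective
      (ℕ.≤-antisym x≤-x
        (≡.subst (toℕ (index (- x)) ℕ.≤_) (≡.cong toℕ (index-cong (-‿involutive x))) -x≤--x)))

    leading-total : ∀ {x} → ¬ Leading x → Leading (- x)
    leading-total {x} x≰-x =
      ≡.subst (toℕ (index (- x)) ℕ.≤_)
        (≡.cong toℕ (index-cong (sym (-‿involutive x)))) (ℕ.≰⇒≥ x≰-x)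

    -- If the elements differ, then `x ≈ - y`, so `y` and `- y` are both leading and hence equal,
    -- which gives `x ≈ y` after all.
    leading-x²≈y² : ∀ {x y} → Leading x → Leading y → x * x ≈ y * y → ¬ x ≉ y
    leading-x²≈y² lx ly x²≈y² x≉y =
      x≉y (trans x≈-y (sym (leading-unique ly (leading-resp x≈-y lx))))
      where x≈-y = x²≈y²∧x≉y⇒x≈-y x²≈y² x≉y

    -- If the elements differ, then `x ≈ - y`, and `- y` is leading because `y` is not.
    ¬leading-x²≈y² : ∀ {x y} → ¬ Leading x → ¬ Leading y → x * x ≈ y * y → ¬ x ≉ y
    ¬leading-x²≈y² ¬lx ¬ly x²≈y² x≉y = ¬lx (leading-resp (sym x≈-y) (leading-total ¬ly))
      where x≈-y = x²≈y²∧x≉y⇒x≈-y x²≈y² x≉y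

    -- Squares of the leading elements and the values -1 - x² for the others are
    -- each pairwise distinct; with the extra value -1 - 0² there are q + 1 of
    -- them, so some square is -1 minus a square.
    squareOrComplement : ∀ x → Dec (Leading x) → Carrier
    squareOrComplement x (yes _) = x * x
    squareOrComplement x (no  _) = - 1# - x * x

    candidate : Fin (suc q) → Carrier
    candidate zero    = - 1#
    candidate (suc i) = squareOrComplement (element i) (leading? (element i))

    x²≈-1-y²⇒x²+y²+1≈0 : ∀ {x y} → x * x ≈ - 1# - y * y → x * x + y * y + 1# ≈ 0#
    x²≈-1-y²⇒x²+y²+1≈0 {x} {y} eq = begin
      x * x + y * y + 1#            ≈⟨ +-congʳ (+-congʳ eq) ⟩
      - 1# - y * y + y * y + 1#
        ≈⟨ solve 2 (λ e z → :- e :- z :+ z :+ e := con (+ 0)) refl 1# (y * y) ⟩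
      0#                            ∎

    ∃[a²+b²+1≈0] : ∃₂ λ a b → a * a + b * b + 1# ≈ 0#
    ∃[a²+b²+1≈0] with pigeonhole (ℕ.n<1+n q) (index ∘ candidate)
    ... | i , j , i<j , eq = fromCollision i j i<j (index-injective eq)
      where
      cancel : ∀ {x y} → - 1# - x ≈ - 1# - y → x ≈ y
      cancel {x} {y} eq = -‿injective (+-cancelˡ (- 1#) (- x) (- y) eq)

      element≉ : ∀ {i j} → toℕ i ℕ.< toℕ j → element i ≉ element j
      element≉ {i} {j} i<j eq = ℕ.<⇒≢ i<j (≡.cong toℕ
        (≡.trans (≡.sym (index-element i)) (≡.trans (index-cong eq) (index-element j))))

      fromCollision : ∀ i j → toℕ i ℕ.< toℕ j → candidate i ≈ candidate j →
                      ∃₂ λ a b → a * a + b * b + 1# ≈ 0#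
      fromCollision zero (suc j) _ eq with leading? (element j)
      -- The extra candidate `- 1#` is -1 - 0², so the second square is that of `0#`.
      ... | yes _  = element j , 0# , x²≈-1-y²⇒x²+y²+1≈0
        (trans (sym eq) (solve 1 (λ e → :- e := :- e :- con (+ 0) :* con (+ 0)) refl 1#))
      -- A non-leading element with square 0 would be 0, which is leading.
      ... | no ¬lx = contradiction
        (λ x≈0 → ¬lx (leading-resp (sym x≈0) leading-0))
        (λ x≉0 → x≉0 (xy≈0∧x≉0⇒y≈0 x²≈0 x≉0))
        where
        x²≈0 : element j * element j ≈ 0#
        x²≈0 = cancel (trans (sym eq) (sym (x-0≈x (- 1#))))
      fromCollision (suc i) (suc j) (s≤s i<j) eq with leading? (element i) | leading? (element j)
      -- Two candidates of the same kind cannot collide; a mixed collision is the wanted equation.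
      ... | yes lx | yes ly = contradiction (element≉ i<j) (leading-x²≈y² lx ly eq)
      ... | yes _  | no  _  = element i , element j , x²≈-1-y²⇒x²+y²+1≈0 eq
      ... | no  _  | yes _  = element j , element i , x²≈-1-y²⇒x²+y²+1≈0 (sym eq)
      ... | no ¬lx | no ¬ly = contradiction (element≉ i<j) (¬leading-x²≈y² ¬lx ¬ly (cancel eq))

  -- The embedding of the affine plane into the projective plane.

  module Embedding {a b} (a²+b²+1≈0 : a * a + b * b + 1# ≈ 0#) (2≉0 : 1# + 1# ≉ 0#) where

    private
      module V² = F² F
      module V³ = F³ F
      module PG = PG2 F

    infix 8 _∙_

    _∙_ : V³.Carrierᴹ → V³.Carrierᴹ → Carrier
    _∙_ = _·_ F

    2x≈0⇒x≈0 : ∀ {x} → (1# + 1#) * x ≈ 0# → x ≈ 0#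
    2x≈0⇒x≈0 2x≈0 = xy≈0∧x≉0⇒y≈0 2x≈0 2≉0

    -- Reduces an equation that depends on a² + b² = -1 to a polynomial identity for the solver. In
    -- each use the cofactor `z` is the coefficient of a² + b² in the expansion of `x`.
    modulo-a²+b²+1 : ∀ {x y} z → x ≈ y + (a * a + b * b + 1#) * z → x ≈ y
    modulo-a²+b²+1 {x} {y} z eq = begin
      x                                  ≈⟨ eq ⟩
      y + (a * a + b * b + 1#) * z       ≈⟨ +-congˡ (*-congʳ a²+b²+1≈0) ⟩
      y + 0# * z                         ≈⟨ +-congˡ (zeroˡ z) ⟩
      y + 0#                             ≈⟨ +-identityʳ y ⟩
      y                                  ∎

    φ : V².Carrierᴹ → V³.Carrierᴹ
    φ (x₁ , x₂) =
      1# + w , a * (1# - w) - (1# + 1#) * b * x₁ , b * (1# - w) + (1# + 1#) * a * x₁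
      where w = x₂ - x₁ * x₁

    φ-cong : ∀ {x y} → x V².≈ᴹ y → φ x V³.≈ᴹ φ y
    φ-cong (x₁≈y₁ , x₂≈y₂) =
      +-congˡ w≈w′ ,
      +-cong (*-congˡ (+-congˡ (-‿cong w≈w′))) (-‿cong (*-congˡ x₁≈y₁)) ,
      +-cong (*-congˡ (+-congˡ (-‿cong w≈w′))) (*-congˡ x₁≈y₁)
      where w≈w′ = +-cong x₂≈y₂ (-‿cong (*-cong x₁≈y₁ x₁≈y₁))

    -- The dot product with g = (1, -a, -b).
    g·_ : V³.Carrierᴹ → Carrier
    g· (v₀ , v₁ , v₂) = v₀ - a * v₁ - b * v₂

    g·-cong : ∀ {u v} → u V³.≈ᴹ v → g· u ≈ g· v
    g·-cong (eq₀ , eq₁ , eq₂) =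
      +-cong (+-cong eq₀ (-‿cong (*-congˡ eq₁))) (-‿cong (*-congˡ eq₂))

    -- Only the e component of `φ x` contributes, since g is orthogonal to f and to itself. This
    -- constant value normalises the homogeneous coordinates.
    g·φ≈2 : ∀ x → g· φ x ≈ 1# + 1#
    g·φ≈2 (x₁ , x₂) = modulo-a²+b²+1 (- (1# - (x₂ - x₁ * x₁)))
      (solve 4 (λ a b x₁ x₂ →
        let 1ₚ = con (+ 1)
            w  = x₂ :- x₁ :* x₁ in
        (1ₚ :+ w)
          :- a :* (a :* (1ₚ :- w) :- (1ₚ :+ 1ₚ) :* b :* x₁)
          :- b :* (b :* (1ₚ :- w) :+ (1ₚ :+ 1ₚ) :* a :* x₁)
        := (1ₚ :+ 1ₚ) :+ (a :* a :+ b :* b :+ 1ₚ) :* (:- (1ₚ :- w)))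
        refl a b x₁ x₂)

    φ-nonzero : ∀ x → ¬ (φ x V³.≈ᴹ V³.0ᴹ)
    φ-nonzero x φx≈0 = 2≉0 (begin
      1# + 1#       ≈⟨ g·φ≈2 x ⟨
      g· φ x        ≈⟨ g·-cong φx≈0 ⟩
      g· V³.0ᴹ
        ≈⟨ solve 2 (λ a b → let 0ₚ = con (+ 0) in 0ₚ :- a :* 0ₚ :- b :* 0ₚ := 0ₚ) refl a b ⟩
      0#            ∎)

    -- The first coordinate 1 + w determines w, the other two determine `x₁`, and x₂ = w + x₁².
    φ-injective : ∀ {x y} → φ x V³.≈ᴹ φ y → x V².≈ᴹ y
    φ-injective {x₁ , x₂} {y₁ , y₂} (eq₀ , eq₁ , eq₂) = x₁≈y₁ , (begin
      x₂                          ≈⟨ [x-y]+y≈x x₂ (x₁ * x₁) ⟨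
      x₂ - x₁ * x₁ + x₁ * x₁      ≈⟨ +-cong (+-cancelˡ 1# _ _ eq₀) (*-cong x₁≈y₁ x₁≈y₁) ⟩
      y₂ - y₁ * y₁ + y₁ * y₁      ≈⟨ [x-y]+y≈x y₂ (y₁ * y₁) ⟩
      y₂                          ∎)
      where
      -- The vector (0, b, -a) is orthogonal to e and g and has dot product 2 with f, so it extracts
      -- the f component.
      bv₁-av₂≈2x₁ : ∀ x₁ x₂ → let (_ , v₁ , v₂) = φ (x₁ , x₂) in b * v₁ - a * v₂ ≈ (1# + 1#) * x₁
      bv₁-av₂≈2x₁ x₁ x₂ = modulo-a²+b²+1 (- ((1# + 1#) * x₁))
        (solve 4 (λ a b x₁ x₂ →
          let 1ₚ = con (+ 1)
              w  = x₂ :- x₁ :* x₁ in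
          b :* (a :* (1ₚ :- w) :- (1ₚ :+ 1ₚ) :* b :* x₁)
            :- a :* (b :* (1ₚ :- w) :+ (1ₚ :+ 1ₚ) :* a :* x₁)
          := (1ₚ :+ 1ₚ) :* x₁ :+ (a :* a :+ b :* b :+ 1ₚ) :* (:- ((1ₚ :+ 1ₚ) :* x₁)))
          refl a b x₁ x₂)
      x₁≈y₁ : x₁ ≈ y₁
      x₁≈y₁ = x∙y⁻¹≈ε⇒x≈y x₁ y₁ (2x≈0⇒x≈0 (trans (x[y-z]≈xy-xz _ x₁ y₁)
        (x≈y⇒x∙y⁻¹≈ε (begin
          (1# + 1#) * x₁  ≈⟨ bv₁-av₂≈2x₁ x₁ x₂ ⟨
          _               ≈⟨ +-cong (*-congˡ eq₁) (-‿cong (*-congˡ eq₂)) ⟩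
          _               ≈⟨ bv₁-av₂≈2x₁ y₁ y₂ ⟩
          (1# + 1#) * y₁  ∎))))

    point : V².Carrierᴹ → Point F
    point x = record { coordinates = φ x ; nonzero = φ-nonzero x }

    coordinates-≈⇒PG-≈ : ∀ {P Q} → coordinates P V³.≈ᴹ coordinates Q → P PG.≈ Q
    coordinates-≈⇒PG-≈ p≈q =
      (λ (k , v≈kp) → k , V³.≈ᴹ-trans v≈kp (V³.*ₗ-congˡ p≈q)) ,
      (λ (k , v≈kq) → k , V³.≈ᴹ-trans v≈kq (V³.*ₗ-congˡ (V³.≈ᴹ-sym p≈q)))

    point-cong : ∀ {x y} → x V².≈ᴹ y → point x PG.≈ point y
    point-cong {x} {y} x≈y = coordinates-≈⇒PG-≈ {point x} {point y} (φ-cong x≈y)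

    -- All φ x lie in the affine plane g· v = 2, so proportional ones coincide.
    point-injective : ∀ {x y} → point x PG.≈ point y → x V².≈ᴹ y
    point-injective {x} {y} (spanx⊆spany , _) =
      let k , φx≈kφy = spanx⊆spany (1# , V³.≈ᴹ-sym (V³.*ₗ-identityˡ (φ x)))
          k≈1 = x∙y⁻¹≈ε⇒x≈y k 1# (2x≈0⇒x≈0 (begin
            (1# + 1#) * (k - 1#)
              ≈⟨ solve 2 (λ t k → t :* (k :- con (+ 1)) := k :* t :- t) refl (1# + 1#) k ⟩
            k * (1# + 1#) - (1# + 1#)
              ≈⟨ x≈y⇒x∙y⁻¹≈ε (begin
              k * (1# + 1#)              ≈⟨ *-congˡ (g·φ≈2 y) ⟨
              k * (g· φ y)               ≈⟨ g·-scale k (φ y) ⟨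
              g· (k V³.*ₗ φ y)           ≈⟨ g·-cong φx≈kφy ⟨
              g· φ x                     ≈⟨ g·φ≈2 x ⟩
              1# + 1#                    ∎) ⟩
            0#                         ∎))
      in φ-injective (V³.≈ᴹ-trans φx≈kφy
           (V³.≈ᴹ-trans (V³.*ₗ-congʳ k≈1) (V³.*ₗ-identityˡ (φ y))))
      where
      g·-scale : ∀ k v → g· (k V³.*ₗ v) ≈ k * (g· v)
      g·-scale k (v₀ , v₁ , v₂) = solve 6 (λ a b k v₀ v₁ v₂ →
        k :* v₀ :- a :* (k :* v₁) :- b :* (k :* v₂) := k :* (v₀ :- a :* v₁ :- b :* v₂))
        refl a b k v₀ v₁ v₂

    -- The products of e, f, g give 2(w + w′) - 4 x₁ y₁, and w + w′ - 2 x₁ y₁ = x₂ + y₂ - (x₁ +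
    -- y₁)².
    φ∙φ : ∀ x₁ x₂ y₁ y₂ →
          φ (x₁ , x₂) ∙ φ (y₁ , y₂) ≈ (1# + 1#) * (x₂ + y₂ - (x₁ + y₁) * (x₁ + y₁))
    φ∙φ x₁ x₂ y₁ y₂ =
      modulo-a²+b²+1
        ((1# - (x₂ - x₁ * x₁)) * (1# - (y₂ - y₁ * y₁)) + (1# + 1#) * (1# + 1#) * x₁ * y₁)
        (solve 6 (λ a b x₁ x₂ y₁ y₂ →
          let 1ₚ = con (+ 1)
              2ₚ = 1ₚ :+ 1ₚ
              w  = x₂ :- x₁ :* x₁
              w′ = y₂ :- y₁ :* y₁ in
          (1ₚ :+ w) :* (1ₚ :+ w′)
            :+ (a :* (1ₚ :- w) :- 2ₚ :* b :* x₁) :* (a :* (1ₚ :- w′) :- 2ₚ :* b :* y₁)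
            :+ (b :* (1ₚ :- w) :+ 2ₚ :* a :* x₁) :* (b :* (1ₚ :- w′) :+ 2ₚ :* a :* y₁)
          := 2ₚ :* (x₂ :+ y₂ :- (x₁ :+ y₁) :* (x₁ :+ y₁))
            :+ (a :* a :+ b :* b :+ 1ₚ) :*
               ((1ₚ :- w) :* (1ₚ :- w′) :+ 2ₚ :* 2ₚ :* x₁ :* y₁))
          refl a b x₁ x₂ y₁ y₂)

    sum∈A⇒orthogonal : ∀ x y → A F (x V².+ᴹ y) → φ x ∙ φ y ≈ 0#
    sum∈A⇒orthogonal x@(x₁ , x₂) y@(y₁ , y₂) (s , s₁≈s , s₂≈s²) = begin
      φ x ∙ φ y
        ≈⟨ φ∙φ x₁ x₂ y₁ y₂ ⟩
      (1# + 1#) * (x₂ + y₂ - (x₁ + y₁) * (x₁ + y₁))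
        ≈⟨ *-congˡ (x≈y⇒x∙y⁻¹≈ε (trans s₂≈s² (*-cong (sym s₁≈s) (sym s₁≈s)))) ⟩
      (1# + 1#) * 0#
        ≈⟨ zeroʳ _ ⟩
      0#  ∎

    orthogonal⇒sum∈A : ∀ x y → φ x ∙ φ y ≈ 0# → A F (x V².+ᴹ y)
    orthogonal⇒sum∈A x@(x₁ , x₂) y@(y₁ , y₂) φx∙φy≈0 =
      -- The first coordinate of the sum forces this witness.
      x₁ + y₁ , refl ,
      x∙y⁻¹≈ε⇒x≈y _ _ (2x≈0⇒x≈0 (trans (sym (φ∙φ x₁ x₂ y₁ y₂)) φx∙φy≈0))

    G-isomorphicToInducedSubgraph-ER : IsomorphicToInducedSubgraph (G F) (ER F)
    G-isomorphicToInducedSubgraph-ER =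
      Image , (λ {P} {Q} → image-resp {P} {Q}) , isomorphism , adjacency
      where
      Image : Point F → Set _
      Image P = ∃ λ x → point x PG.≈ P
      image-resp : ∀ {P Q} → P PG.≈ Q → Image P → Image Q
      image-resp {P} {Q} P≈Q (x , x≈P) = x , PG.trans {point x} {P} {Q} x≈P P≈Q
      isomorphism : Inverse V².≈ᴹ-setoid (Graph.vertices (induced (ER F) Image))
      isomorphism = record
        { to        = λ x → point x , x , PG.refl {point x}
        -- Membership in `Image` carries a preimage; `point-injective` makes the choice irrelevant.
        ; from      = λ (_ , x , _) → x
        ; to-cong   = λ {x} {y} → point-cong {x} {y}
        ; from-cong = λ {(P , x , x≈P)} {(Q , y , y≈Q)} P≈Q →
            point-injective (PG.trans {point x} {P} {point y} x≈P
              (PG.trans {P} {Q} {point y} P≈Q (PG.sym {point y} {Q} y≈Q)))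
        ; inverse   =
            (λ {(P , x , x≈P)} {y} y≈x →
              PG.trans {point y} {point x} {P} (point-cong {y} {x} y≈x) x≈P) ,
            (λ {x} {(P , y , y≈P)} P≈x →
              point-injective (PG.trans {point y} {P} {point x} y≈P P≈x))
        }
      adjacency : ∀ x y → _
      -- If x + x lies in `A`, then `φ x` is orthogonal to itself, so distinctness has to be
      -- transported along with orthogonality.
      adjacency x y = mk⇔
        (λ (x≉y , x+y∈A) →
          (λ eq → x≉y (point-injective {x} {y} eq)) , sum∈A⇒orthogonal x y x+y∈A)
        (λ (x≉y , φx∙φy≈0) →
          (λ eq → x≉y (point-cong {x} {y} eq)) , orthogonal⇒sum∈A x y φx∙φy≈0)

-- Fields of odd prime power order.

theorem1p4 : ∀ {c ℓ₁ ℓ₂} (F : HeytingField c ℓ₁ ℓ₂) (q : ℕ) →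
    IsOddPrimePower q → HasOrder F q →
    IsomorphicToInducedSubgraph (G F) (ER F)
theorem1p4 F q (p , k , _ , 2∤p , _ , ≡.refl) order =
  let _ , _ , a²+b²+1≈0 = ∃[a²+b²+1≈0] F order in
  Embedding.G-isomorphicToInducedSubgraph-ER F a²+b²+1≈0
    -- In characteristic 2 the order p^k would be even, and then so would `p`.
    (λ 2≈0 → 2∤p (2∣m^n⇒2∣m p k (2×1≈0∧n×1≈0⇒2∣n F 2≈0 q (order×1≈0 F order))))
  where open FiniteOrder
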